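{- For all $k\le n$ and every simple graph with $n$ vertices, $$I(\overline{K}_k)=\sum_{A\subseteq K_k}(-1)^{|A|}\binom{n-cv(A)}{k-cv(A)}I(A),$$ where the sum is over all unlabeled subgraphs $A$ of the complete graph $K_k$ (isomorphism classes of graphs without isolated vertices contained in $K_k$, including the empty graph).
   Context: Graphs are finite and simple. For a graph $h$, $I(\overline{K}_k)(h)$ denotes the number of independent sets of order $k$ in $h$, and $I(A)(h)$ the number of (not necessarily induced) subgraphs of $h$ isomorphic to $A$, with $I(\emptyset)=1$ for the empty graph. The identity is between functions of the graph $h$ on $n$ vertices. $|A|$ is the number of edges of $A$ and $cv(A)$ is the number of vertices connected to edges of $A$. -}

module Defs where

open import Level using (0ℓ)
open import Data.Fin.Base using (Fin; zero; suc; finToFun; funToFin)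
open import Data.Fin.Properties using (_≟_; _<?_; all?; any?; finToFun-funToFin)
open import Data.Fin.Subset using (Subset; _∈_; ∣_∣; inside; outside)
open import Data.Fin.Subset.Properties using (_∈?_)
open import Data.Integer.Base as ℤ using (ℤ; 0ℤ)
open import Data.List.Base
  using (List; []; _∷_; [_]; length; filter; map; foldr; allFin; cartesianProduct;
         cartesianProductWith; deduplicate)
open import Data.Nat.Base using (ℕ; zero; suc)
import Data.Nat.Properties as ℕ
open import Data.Product.Base using (∃; Σ-syntax; ∃-syntax; _×_; _,_; proj₁; proj₂)
open import Data.Vec.Base using (Vec; []; _∷_; lookup; here; there)
open import Function.Base using (_∘_)
open import Function.Bundles using (_↔_; _⇔_; Inverse; Equivalence; mk↔ₛ′; mk⇔)
open import Function.Construct.Composition using (_↔-∘_)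
open import Function.Construct.Symmetry using (↔-sym)
open import Relation.Binary.Core using (Rel)
import Relation.Binary.Definitions as B
open import Relation.Binary.PropositionalEquality
  using (_≡_; _≢_; _≗_; refl; sym; trans; cong; subst₂; ≢-sym)
open import Relation.Nullary using (¬_; Dec; ¬?)
open import Relation.Nullary.Decidable using (map′; _×-dec_; _→-dec_)
open import Relation.Unary using (Pred; Decidable)

private
  variable
    m n : ℕ

------------------------------------------------------------------------
-- Finite simple graphs

record SimpleGraph (n : ℕ) : Set₁ where
  field
    Adj    : Rel (Fin n) 0ℓ
    adj?   : B.Decidable Adj
    symm   : B.Symmetric Adj
    irrefl : ∀ {v} → ¬ Adj v v

open SimpleGraph public

K : ∀ k → SimpleGraph k
K k = record
  { Adj    = _≢_
  ; adj?   = λ u v → ¬? (u ≟ v)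
  ; symm   = ≢-sym
  ; irrefl = λ v≢v → v≢v refl
  }

------------------------------------------------------------------------
-- Subgraphs

-- Raw data of a subgraph of a graph on Fin n: a vertex set and an
-- adjacency matrix, whose row u is the set of neighbours of u.
-- Propositional equality of this data is equality of subgraphs.

record Subgraph (n : ℕ) : Set where
  constructor subgraph
  field
    vertices : Subset n
    rows     : Vec (Subset n) n

  Edge : Rel (Fin n) 0ℓ
  Edge u v = v ∈ lookup rows u

  edge? : B.Decidable Edge
  edge? u v = v ∈? lookup rows u

  V : Set
  V = ∃[ v ] v ∈ vertices

  E : Rel V 0ℓ
  E (u , _) (v , _) = Edge u v

open Subgraph public

record _IsSubgraphOf_ (S : Subgraph n) (h : SimpleGraph n) : Set where
  field
    edge-sym      : ∀ u v → Edge S u v → Edge S v u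
    edge-vertices : ∀ u v → Edge S u v → u ∈ vertices S × v ∈ vertices S
    edge-adj      : ∀ u v → Edge S u v → Adj h u v

isSubgraphOf? : (h : SimpleGraph n) → Decidable (_IsSubgraphOf h)
isSubgraphOf? h S = map′
  (λ (p , q , r) → record { edge-sym = p ; edge-vertices = q ; edge-adj = r })
  (λ s → let open _IsSubgraphOf_ s in edge-sym , edge-vertices , edge-adj)
  (   all? (λ u → all? λ v → edge? S u v →-dec edge? S v u)
  ×-dec all? (λ u → all? λ v → edge? S u v →-dec
               (u ∈? vertices S ×-dec v ∈? vertices S))
  ×-dec all? (λ u → all? λ v → edge? S u v →-dec adj? h u v))

NoIsolatedVertices : Subgraph n → Set
NoIsolatedVertices S = ∀ u → u ∈ vertices S → ∃[ v ] Edge S u v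

noIsolatedVertices? : Decidable (NoIsolatedVertices {n})
noIsolatedVertices? S = all? λ u → (u ∈? vertices S) →-dec any? (edge? S u)

------------------------------------------------------------------------
-- Isomorphism

PreservesAdj : {A B : Set} → Rel A 0ℓ → Rel B 0ℓ → (A → B) → Set
PreservesAdj R S f = ∀ x y → R x y ⇔ S (f x) (f y)

_≅_ : Subgraph m → Subgraph n → Set
S ≅ T = Σ[ φ ∈ V S ↔ V T ] PreservesAdj (E S) (E T) (Inverse.to φ)

-- Decidability of ≅: number the vertices of both graphs and search through
-- all maps Fin a → Fin b.

private
  ∃fun? : ∀ {a b} {P : (Fin a → Fin b) → Set} →
          (∀ {f g} → f ≗ g → P f → P g) → Decidable P → Dec (∃ P)
  ∃fun? resp P? = map′
    (λ (c , p) → finToFun c , p)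
    (λ (f , p) → funToFin f , resp (λ x → sym (finToFun-funToFin f x)) p)
    (any? (P? ∘ finToFun))

  UniquePreimages : ∀ {a b} → (Fin a → Fin b) → Set
  UniquePreimages f = ∀ y → ∃[ x ] (f x ≡ y × (∀ x′ → f x′ ≡ y → x′ ≡ x))

  uniquePreimages? : ∀ {a b} → Decidable (UniquePreimages {a} {b})
  uniquePreimages? f = all? λ y → any? λ x →
    (f x ≟ y) ×-dec all? λ x′ → (f x′ ≟ y) →-dec (x′ ≟ x)

  uniquePreimages-resp : ∀ {a b} {f g : Fin a → Fin b} → f ≗ g →
                         UniquePreimages f → UniquePreimages g
  uniquePreimages-resp f≗g u y with u y
  ... | x , fx≡y , uniq =
    x , trans (sym (f≗g x)) fx≡y , λ x′ gx′≡y → uniq x′ (trans (f≗g x′) gx′≡y)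

  ⇔? : {A B : Set} → Dec A → Dec B → Dec (A ⇔ B)
  ⇔? A? B? = map′ (λ (f , g) → mk⇔ f g) (λ e → Equivalence.to e , Equivalence.from e)
    ((A? →-dec B?) ×-dec (B? →-dec A?))

  module _ {A B : Set} {R : Rel A 0ℓ} {S : Rel B 0ℓ}
           (R? : B.Decidable R) (S? : B.Decidable S)
           {a b : ℕ} (α : Fin a ↔ A) (β : Fin b ↔ B) where

    module α = Inverse α
    module β = Inverse β

    Preserves : (Fin a → Fin b) → Set
    Preserves f = ∀ x y → R (α.to x) (α.to y) ⇔ S (β.to (f x)) (β.to (f y))

    Good : (Fin a → Fin b) → Set
    Good f = UniquePreimages f × Preserves f

    good? : Decidable Good
    good? f = uniquePreimages? f ×-dec
      all? λ x → all? λ y → ⇔? (R? _ _) (S? _ _)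

    good-resp : ∀ {f g} → f ≗ g → Good f → Good g
    good-resp f≗g (u , p) = uniquePreimages-resp f≗g u , λ x y →
      subst₂ (λ s t → R (α.to x) (α.to y) ⇔ S (β.to s) (β.to t)) (f≗g x) (f≗g y) (p x y)

    good⇒iso : ∃ Good → Σ[ φ ∈ A ↔ B ] PreservesAdj R S (Inverse.to φ)
    good⇒iso (f , u , p) = (β ↔-∘ (φ ↔-∘ ↔-sym α)) , λ x y →
      subst₂ (λ s t → R s t ⇔ S (β.to (f (α.from x))) (β.to (f (α.from y))))
        (α.strictlyInverseˡ x) (α.strictlyInverseˡ y) (p (α.from x) (α.from y))
      where
      φ : Fin a ↔ Fin b
      φ = mk↔ₛ′ f (proj₁ ∘ u) (λ y → proj₁ (proj₂ (u y)))
            (λ x → sym (proj₂ (proj₂ (u (f x))) x refl))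

    iso⇒good : Σ[ φ ∈ A ↔ B ] PreservesAdj R S (Inverse.to φ) → ∃ Good
    iso⇒good (φ , p) = ψ.to
      , (λ y → ψ.from y , ψ.strictlyInverseˡ y
             , λ x e → trans (sym (ψ.strictlyInverseʳ x)) (cong ψ.from e))
      , λ x y → subst₂ (λ s t → R (α.to x) (α.to y) ⇔ S s t)
          (sym (β.strictlyInverseˡ _)) (sym (β.strictlyInverseˡ _))
          (p (α.to x) (α.to y))
      where
      ψ : Fin a ↔ Fin b
      ψ = ↔-sym β ↔-∘ (φ ↔-∘ α)
      module ψ = Inverse ψ

    iso? : Dec (Σ[ φ ∈ A ↔ B ] PreservesAdj R S (Inverse.to φ))
    iso? = map′ good⇒iso iso⇒good (∃fun? good-resp good?)

elements : (p : Subset n) → Fin ∣ p ∣ ↔ (∃[ v ] v ∈ p)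
elements p = mk↔ₛ′ (to p) (from p) (to-from p) (from-to p)
  where
  to : (p : Subset n) → Fin ∣ p ∣ → ∃[ v ] v ∈ p
  to (outside ∷ p) i       = let (v , v∈p) = to p i in suc v , there v∈p
  to (inside  ∷ p) zero    = zero , here
  to (inside  ∷ p) (suc i) = let (v , v∈p) = to p i in suc v , there v∈p

  from : (p : Subset n) → (∃[ v ] v ∈ p) → Fin ∣ p ∣
  from (outside ∷ p) (suc v , there v∈p) = from p (v , v∈p)
  from (inside  ∷ p) (zero  , here)      = zero
  from (inside  ∷ p) (suc v , there v∈p) = suc (from p (v , v∈p))

  lift : ∀ {s} {p : Subset n} → (∃[ v ] v ∈ p) → ∃[ v ] v ∈ (s ∷ p)
  lift (v , v∈p) = suc v , there v∈p

  to-from : (p : Subset n) → ∀ x → to p (from p x) ≡ x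
  to-from (outside ∷ p) (suc v , there v∈p) = cong lift (to-from p (v , v∈p))
  to-from (inside  ∷ p) (zero  , here)      = refl
  to-from (inside  ∷ p) (suc v , there v∈p) = cong lift (to-from p (v , v∈p))

  from-to : (p : Subset n) → ∀ i → from p (to p i) ≡ i
  from-to (outside ∷ p) i       = from-to p i
  from-to (inside  ∷ p) zero    = refl
  from-to (inside  ∷ p) (suc i) = cong suc (from-to p i)

_≅?_ : (S : Subgraph m) (T : Subgraph n) → Dec (S ≅ T)
S ≅? T = iso? (λ (u , _) (v , _) → edge? S u v) (λ (u , _) (v , _) → edge? T u v)
              (elements (vertices S)) (elements (vertices T))

------------------------------------------------------------------------
-- Enumeration

vectors : {A : Set} → List A → ∀ n → List (Vec A n)
vectors xs zero    = [ [] ]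
vectors xs (suc n) = cartesianProductWith _∷_ xs (vectors xs n)

subsets : ∀ n → List (Subset n)
subsets n = vectors (outside ∷ inside ∷ []) n

subgraphs : SimpleGraph n → List (Subgraph n)
subgraphs {n} h =
  filter (isSubgraphOf? h) (cartesianProductWith subgraph (subsets n) (vectors (subsets n) n))

-- One representative of each isomorphism class of subgraphs of h without
-- isolated vertices.

unlabeledSubgraphs : SimpleGraph n → List (Subgraph n)
unlabeledSubgraphs h = deduplicate _≅?_ (filter noIsolatedVertices? (subgraphs h))

------------------------------------------------------------------------
-- Invariants

IsIndependent : SimpleGraph n → Pred (Subset n) 0ℓ
IsIndependent h s = ∀ u v → u ∈ s → v ∈ s → ¬ Adj h u v

isIndependent? : (h : SimpleGraph n) → Decidable (IsIndependent h)
isIndependent? h s = all? λ u → all? λ v →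
  (u ∈? s) →-dec ((v ∈? s) →-dec ¬? (adj? h u v))

independentSets : ℕ → SimpleGraph n → List (Subset n)
independentSets {n} k h =
  filter (λ s → (∣ s ∣ ℕ.≟ k) ×-dec isIndependent? h s) (subsets n)

-- I(K̄ₖ)(h)
I-K̄ : ℕ → SimpleGraph n → ℕ
I-K̄ k h = length (independentSets k h)

-- I(A)(h); it is 1 for the empty A, the only copy being the subgraph of h
-- with no vertices.
I : Subgraph m → SimpleGraph n → ℕ
I A h = length (filter (A ≅?_) (subgraphs h))

-- |A|; each edge is counted once, as a pair u < v.
edgeCount : Subgraph n → ℕ
edgeCount {n} A =
  length (filter (λ (u , v) → (u <? v) ×-dec edge? A u v)
                 (cartesianProduct (allFin n) (allFin n)))

cv : Subgraph n → ℕ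
cv {n} A = length (filter (λ u → any? (edge? A u)) (allFin n))

∑ : {A : Set} → List A → (A → ℤ) → ℤ
∑ xs f = foldr ℤ._+_ 0ℤ (map f xs)

syntax ∑ xs (λ x → e) = ∑[ x ∈ xs ] e

module Submission where

-- Swapping the two sums, the right-hand side becomes a sum over the subgraphs S
-- of h without isolated vertices, because each S with at most k vertices is
-- isomorphic to exactly one A. The binomial coefficient counts the k-subsets p
-- of vertices containing the vertices of S, so swapping once more leaves, for
-- each k-subset p, the sum of (-1)^|S| over the S living inside p. If h has an
-- edge ab inside p, toggling ab in S is a sign-reversing involution and this sum
-- vanishes; otherwise only the empty S contributes, and the sum is 1.

open import Defs
open import Algebra.Properties.CommutativeSemigroup using (interchange)
open import Data.Bool.Base using (true; false; if_then_else_)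
open import Data.Empty using (⊥; ⊥-elim)
open import Data.Fin.Base using (Fin; zero; suc; inject≤; _<_)
open import Data.Fin.Permutation using (↔⇒≡)
open import Data.Fin.Properties using (_≟_; any?; inject≤-injective; <-cmp; <-asym; _<?_)
open import Data.Fin.Subset using (Subset; ∣_∣; inside; outside; _∈_; _⊆_)
open import Data.Fin.Subset.Properties
  using (_∈?_; _⊆?_; ⊆-antisym; ∣p∣≤n; p⊆q⇒∣p∣≤∣q∣; drop-∷-⊆; out⊆; in⊆in)
open import Data.Integer.Base using (ℤ; +_; 0ℤ; 1ℤ; -1ℤ; _+_; _*_; -_; _^_)
import Data.Integer.Properties as ℤ
open import Data.List.Base
  using (List; []; _∷_; _++_; length; map; filter; foldr; allFin; cartesianProduct;
         cartesianProductWith; deduplicate)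
import Data.List.Membership.Propositional as List
open import Data.List.Membership.Propositional.Properties
  using (∈-∃++; ∈-cartesianProductWith⁺; ∈-cartesianProduct⁺; ∈-filter⁺; ∈-filter⁻; ∈-allFin;
         ∈-deduplicate⁻)
open import Data.List.Properties using (map-∘; ++-identityʳ; length-tabulate; filter-none)
open import Data.List.Relation.Binary.Permutation.Propositional using (_↭_; ↭-sym; ↭⇒↭ₛ)
open import Data.List.Relation.Binary.Permutation.Propositional.Properties
  using (∈-resp-↭; shift; map⁺)
import Data.List.Relation.Binary.Permutation.Setoid.Properties as Permutationₛ
open import Data.List.Relation.Unary.All as All using ([]; _∷_)
import Data.List.Relation.Unary.All.Properties as All
open import Data.List.Relation.Unary.AllPairs as AllPairs using (AllPairs; []; _∷_)
import Data.List.Relation.Unary.AllPairs.Properties as AllPairs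
open import Data.List.Relation.Unary.Any using (here; there)
import Data.List.Relation.Unary.Any.Properties as Any
open import Data.List.Relation.Unary.Unique.Propositional using (Unique)
import Data.List.Relation.Unary.Unique.Propositional.Properties as Unique
open import Data.Nat.Base as ℕ using (ℕ; zero; suc; _≤_; _∸_)
open import Data.Nat.Combinatorics using (_C_; nCk+nC[k+1]≡[n+1]C[k+1])
import Data.Nat.Properties as ℕ
open import Data.Product.Base using (∃-syntax; _×_; _,_; proj₁; proj₂)
open import Data.Sum.Base as Sum using (_⊎_; inj₁; inj₂)
open import Data.Vec.Base as Vec using (Vec; []; _∷_; tabulate)
open import Data.Vec.Properties using (∷-injective; lookup∘tabulate; []=⇒lookup; lookup⇒[]=)
open import Data.Vec.Properties.WithK using ([]=-irrelevant)
import Data.Vec.Relation.Binary.Pointwise.Extensional as Pointwise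
open import Function.Base using (_∘_; id; case_of_)
open import Function.Bundles using (_↔_; _⇔_; Inverse; Equivalence; mk↔ₛ′; mk⇔)
open import Function.Construct.Composition using (_↔-∘_; _⇔-∘_)
open import Function.Construct.Identity using (↔-id; ⇔-id)
open import Function.Construct.Symmetry using (↔-sym; ⇔-sym)
open import Level using (0ℓ)
open import Relation.Binary.Core using (Rel; _⇒_)
open import Relation.Binary.Definitions as B using (Symmetric; tri<; tri≈; tri>)
open import Relation.Binary.PropositionalEquality
  using (_≡_; _≢_; refl; sym; trans; cong; cong₂; subst; subst₂; setoid; module ≡-Reasoning)
open import Relation.Nullary using (¬_; Dec; yes; no; does; contradiction; ¬?)
open import Relation.Nullary.Decidable
  using (_×-dec_; _⊎-dec_; dec-true; dec-false; decidable-stable)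
open import Relation.Unary using (Pred; Decidable)

open _IsSubgraphOf_

-- The classes `A` live on `Fin k` and the subgraphs `S` on `Fin n`, so matching them needs two
-- transfers. The edge and vertex counts must be invariant under `≅`, and a small `S` must be copied
-- into `K k` before a representative can be found. Having no isolated vertices matters twice: such
-- a subgraph is determined by its edges, which makes toggling an involution on equality of
-- subgraphs, and its vertex set has size `cv`, which makes the binomial coefficient count supersets
-- of `vertices S`. A subgraph with more than `k` vertices needs its own argument: it matches no `A`
-- and lies in no `k`-subset, so it contributes zero on both sides.

private
  variable
    A B P Q : Set
    l m n : ℕ

-- Finite sums

-- A sign-reversing involution only shows that a sum equals its own negative; this finishes the
-- cancellation.
i≡-i⇒i≡0 : ∀ z → z ≡ - z → z ≡ 0ℤ
i≡-i⇒i≡0 (+ 0) _ = refl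

-- Iverson bracket. It moves the condition of a filter into the summand, so that the index lists
-- become independent and sums can be exchanged.
when : Dec P → ℤ → ℤ
when p z = if does p then z else 0ℤ

when-yes : (p : Dec P) → P → ∀ {z} → when p z ≡ z
when-yes p x rewrite dec-true p x = refl

when-no : (p : Dec P) → ¬ P → ∀ {z} → when p z ≡ 0ℤ
when-no p ¬x rewrite dec-false p ¬x = refl

when-zero : (p : Dec P) → when p 0ℤ ≡ 0ℤ
when-zero (yes _) = refl
when-zero (no _)  = refl

when-cong : (p : Dec P) (q : Dec Q) → (P → Q) → (Q → P) →
            ∀ {y z} → (P → y ≡ z) → when p y ≡ when q z
when-cong (yes x) q f g e = trans (e x) (sym (when-yes q (f x)))
when-cong (no ¬x) q f g e = sym (when-no q (¬x ∘ g))

when-× : (p : Dec P) (q : Dec Q) → ∀ {z} → when (p ×-dec q) z ≡ when p (when q z)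
when-× (yes _) q = refl
when-× (no _)  q = refl

*-when : ∀ c (p : Dec P) {z} → c * when p z ≡ when p (c * z)
*-when c (yes _) = refl
*-when c (no _)  = ℤ.*-zeroʳ c

∑-cong-∈ : ∀ (xs : List A) {f g} → (∀ {x} → x List.∈ xs → f x ≡ g x) → ∑ xs f ≡ ∑ xs g
∑-cong-∈ []       e = refl
∑-cong-∈ (x ∷ xs) e = cong₂ _+_ (e (here refl)) (∑-cong-∈ xs (e ∘ there))

∑-cong : ∀ (xs : List A) {f g} → (∀ x → f x ≡ g x) → ∑ xs f ≡ ∑ xs g
∑-cong xs e = ∑-cong-∈ xs (λ {x} _ → e x)

∑-zero : ∀ (xs : List A) {f} → (∀ {x} → x List.∈ xs → f x ≡ 0ℤ) → ∑ xs f ≡ 0ℤ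
∑-zero []       e = refl
∑-zero (x ∷ xs) e = cong₂ _+_ (e (here refl)) (∑-zero xs (e ∘ there))

∑-distrib-+ : ∀ (xs : List A) f g → ∑[ x ∈ xs ] (f x + g x) ≡ ∑ xs f + ∑ xs g
∑-distrib-+ []       f g = refl
∑-distrib-+ (x ∷ xs) f g =
  trans (cong (_+_ (f x + g x)) (∑-distrib-+ xs f g)) (interchange ℤ.+-commutativeSemigroup (f x) (g x) _ _)

∑-distribˡ-* : ∀ c (xs : List A) f → c * ∑ xs f ≡ ∑[ x ∈ xs ] (c * f x)
∑-distribˡ-* c []       f = ℤ.*-zeroʳ c
∑-distribˡ-* c (x ∷ xs) f =
  trans (ℤ.*-distribˡ-+ c (f x) _) (cong (_+_ (c * f x)) (∑-distribˡ-* c xs f))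

∑-neg : ∀ (xs : List A) f → ∑[ x ∈ xs ] (- f x) ≡ - ∑ xs f
∑-neg []       f = refl
∑-neg (x ∷ xs) f = trans (cong (_+_ (- f x)) (∑-neg xs f)) (sym (ℤ.neg-distrib-+ (f x) _))

∑-comm : ∀ (xs : List A) (ys : List B) (f : A → B → ℤ) →
         ∑[ x ∈ xs ] ∑[ y ∈ ys ] f x y ≡ ∑[ y ∈ ys ] ∑[ x ∈ xs ] f x y
∑-comm []       ys f = sym (∑-zero ys (λ _ → refl))
∑-comm (x ∷ xs) ys f =
  trans (cong (_+_ (∑ ys (f x))) (∑-comm xs ys f)) (sym (∑-distrib-+ ys (f x) _))

∑-++ : ∀ (xs ys : List A) f → ∑ (xs ++ ys) f ≡ ∑ xs f + ∑ ys f
∑-++ []       ys f = sym (ℤ.+-identityˡ _)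
∑-++ (x ∷ xs) ys f = trans (cong (_+_ (f x)) (∑-++ xs ys f)) (sym (ℤ.+-assoc (f x) _ _))

∑-map : ∀ (g : A → B) xs f → ∑ (map g xs) f ≡ ∑ xs (f ∘ g)
∑-map g xs f = cong (foldr _+_ 0ℤ) (sym (map-∘ xs))

∑-filter : {P : Pred A 0ℓ} (P? : Decidable P) → ∀ xs f →
           ∑ (filter P? xs) f ≡ ∑[ x ∈ xs ] when (P? x) (f x)
∑-filter P? []       f = refl
∑-filter P? (x ∷ xs) f with does (P? x)
... | true  = cong (_+_ (f x)) (∑-filter P? xs f)
... | false = trans (∑-filter P? xs f) (sym (ℤ.+-identityˡ _))

∑-when : (p : Dec P) (xs : List A) (f : A → ℤ) →
         ∑[ x ∈ xs ] when p (f x) ≡ when p (∑ xs f)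
∑-when (yes _) xs f = refl
∑-when (no _)  xs f = ∑-zero xs (λ _ → refl)

∑-length : ∀ (xs : List A) → ∑[ x ∈ xs ] 1ℤ ≡ + length xs
∑-length []       = refl
∑-length (x ∷ xs) = cong (_+_ (1ℤ)) (∑-length xs)

length-filter-∑ : {P : Pred A 0ℓ} (P? : Decidable P) → ∀ xs →
                  + length (filter P? xs) ≡ ∑[ x ∈ xs ] when (P? x) 1ℤ
length-filter-∑ P? xs = trans (sym (∑-length (filter P? xs))) (∑-filter P? xs _)

∑-↭ : ∀ {xs ys : List A} f → xs ↭ ys → ∑ xs f ≡ ∑ ys f
∑-↭ f xs↭ys =
  Permutationₛ.foldr-commMonoid (setoid ℤ) ℤ.+-0-isCommutativeMonoid (↭⇒↭ₛ (map⁺ f xs↭ys))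

∑-single : ∀ {xs : List A} {f x} → Unique xs → x List.∈ xs →
           (∀ {y} → y List.∈ xs → y ≢ x → f y ≡ 0ℤ) → ∑ xs f ≡ f x
∑-single {f = f} {x} (x∉xs ∷ _) (here refl) e =
  trans (cong (_+_ (f x)) (∑-zero _ (λ y∈xs → e (there y∈xs) (All.lookup x∉xs y∈xs ∘ sym))))
        (ℤ.+-identityʳ (f x))
∑-single (y∉xs ∷ u) (there x∈xs) e =
  trans (cong₂ _+_ (e (here refl) (All.lookup y∉xs x∈xs)) (∑-single u x∈xs (e ∘ there)))
        (ℤ.+-identityˡ _)

module _ {R : A → B → Set} {f : A → ℤ} {g : B → ℤ}
  (injective  : ∀ {x x′ y} → R x y → R x′ y → x ≡ x′)
  (functional : ∀ {x y y′} → R x y → R x y′ → y ≡ y′)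
  (f≡g        : ∀ {x y} → R x y → f x ≡ g y) where

  -- Induction on `xs`: the partner of the head is moved to the front of `ys` and removed, and the
  -- laws of `R` keep the tails matched. A relation is used instead of a function because some
  -- correspondences below depend on membership proofs or on a choice of orientation.
  ∑-bijection : ∀ {xs ys} → Unique xs → Unique ys →
                (∀ {x} → x List.∈ xs → ∃[ y ] y List.∈ ys × R x y) →
                (∀ {y} → y List.∈ ys → ∃[ x ] x List.∈ xs × R x y) →
                ∑ xs f ≡ ∑ ys g
  ∑-bijection {[]} {[]}    _ _ _ _ = refl
  ∑-bijection {[]} {_ ∷ _} _ _ _ surjective with () ← proj₁ (proj₂ (surjective (here refl)))
  ∑-bijection {x ∷ xs} (x∉xs ∷ uxs) uys total surjective
    with y , y∈ys , xRy ← total (here refl)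
    with ys₁ , ys₂ , refl ← ∈-∃++ y∈ys
    with y∉zs ∷ uzs ← Permutationₛ.Unique-resp-↭ (setoid B) (↭⇒↭ₛ (shift y ys₁ ys₂)) uys
    = trans (cong₂ _+_ (f≡g xRy) (∑-bijection uxs uzs total′ surjective′))
            (sym (∑-↭ g (shift y ys₁ ys₂)))
    where
    total′ : ∀ {x′} → x′ List.∈ xs → ∃[ y′ ] y′ List.∈ ys₁ ++ ys₂ × R x′ y′
    total′ x′∈xs with total (there x′∈xs)
    ... | y′ , y′∈ys , x′Ry′ with ∈-resp-↭ (shift y ys₁ ys₂) y′∈ys
    ...   | here refl    = contradiction (injective xRy x′Ry′) (All.lookup x∉xs x′∈xs)
    ...   | there y′∈zs = y′ , y′∈zs , x′Ry′

    surjective′ : ∀ {y′} → y′ List.∈ ys₁ ++ ys₂ → ∃[ x′ ] x′ List.∈ xs × R x′ y′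
    surjective′ y′∈zs with surjective (∈-resp-↭ (↭-sym (shift y ys₁ ys₂)) (there y′∈zs))
    ... | _  , here refl     , xRy′  =
      contradiction (functional xRy xRy′) (All.lookup y∉zs y′∈zs)
    ... | x′ , there x′∈xs , x′Ry′ = x′ , x′∈xs , x′Ry′

length-bijection : {R : A → B → Set} →
                   (∀ {x x′ y} → R x y → R x′ y → x ≡ x′) →
                   (∀ {x y y′} → R x y → R x y′ → y ≡ y′) →
                   ∀ {xs ys} → Unique xs → Unique ys →
                   (∀ {x} → x List.∈ xs → ∃[ y ] y List.∈ ys × R x y) →
                   (∀ {y} → y List.∈ ys → ∃[ x ] x List.∈ xs × R x y) →
                   length xs ≡ length ys
length-bijection i f {xs} {ys} uxs uys t s = ℤ.+-injective
  (trans (sym (∑-length xs)) (trans (∑-bijection i f (λ _ → refl) uxs uys t s) (∑-length ys)))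

-- Read off from the difference of the two indicator sums, which has a single
-- nonzero term.
length-filter-suc : {P Q : Pred A 0ℓ} (P? : Decidable P) (Q? : Decidable Q) →
                    ∀ {xs x} → Unique xs → x List.∈ xs → ¬ P x → Q x →
                    (∀ y → y ≢ x → P y → Q y) → (∀ y → y ≢ x → Q y → P y) →
                    length (filter Q? xs) ≡ suc (length (filter P? xs))
length-filter-suc P? Q? {xs} {x} u x∈xs ¬Px Qx P⇒Q Q⇒P = ℤ.+-injective (begin
  + length (filter Q? xs)                        ≡⟨ length-filter-∑ Q? xs ⟩
  ∑ xs q                                         ≡⟨ ℤ.+-identityʳ _ ⟨
  ∑ xs q + 0ℤ                                    ≡⟨ cong (_+_ (∑ xs q)) (ℤ.+-inverseˡ (∑ xs p)) ⟨
  ∑ xs q + (- ∑ xs p + ∑ xs p)                   ≡⟨ ℤ.+-assoc (∑ xs q) _ _ ⟨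
  (∑ xs q + - ∑ xs p) + ∑ xs p                   ≡⟨ cong (λ z → (∑ xs q + z) + ∑ xs p) (∑-neg xs p) ⟨
  (∑ xs q + ∑[ y ∈ xs ] (- p y)) + ∑ xs p        ≡⟨ cong (_+ ∑ xs p) (∑-distrib-+ xs q (-_ ∘ p)) ⟨
  ∑[ y ∈ xs ] (q y + - p y) + ∑ xs p             ≡⟨ cong (_+ ∑ xs p) difference ⟩
  1ℤ + ∑ xs p                                    ≡⟨ cong (λ z → 1ℤ + z) (length-filter-∑ P? xs) ⟨
  + suc (length (filter P? xs))                  ∎)
  where
  open ≡-Reasoning
  p q : _ → ℤ
  p y = when (P? y) 1ℤ
  q y = when (Q? y) 1ℤ

  difference : ∑[ y ∈ xs ] (q y + - p y) ≡ 1ℤ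
  difference = trans
    (∑-single u x∈xs λ {y} _ y≢x → trans
      (cong (λ z → q y + - z)
            (when-cong (P? y) (Q? y) (P⇒Q y y≢x) (Q⇒P y y≢x) (λ _ → refl)))
      (ℤ.+-inverseʳ (q y)))
    (cong₂ (λ s t → s + - t) (when-yes (Q? x) Qx) (when-no (P? x) ¬Px))

-- Counting subsets

vectors-complete : ∀ {xs : List A} → (∀ x → x List.∈ xs) → (v : Vec A n) → v List.∈ vectors xs n
vectors-complete complete []      = here refl
vectors-complete complete (x ∷ v) =
  ∈-cartesianProductWith⁺ _∷_ (complete x) (vectors-complete complete v)

vectors-unique : ∀ {xs : List A} → Unique xs → ∀ n → Unique (vectors xs n)
vectors-unique u zero    = [] ∷ []
vectors-unique u (suc n) = Unique.cartesianProductWith⁺ _∷_ ∷-injective u (vectors-unique u n)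

subsets-complete : (p : Subset n) → p List.∈ subsets n
subsets-complete = vectors-complete λ where
  outside → here refl
  inside  → there (here refl)

subsets-unique : ∀ n → Unique (subsets n)
subsets-unique = vectors-unique (((λ ()) ∷ []) ∷ [] ∷ [])

∑-subsets : ∀ n f → ∑ (subsets (suc n)) f ≡
            ∑[ p ∈ subsets n ] f (outside ∷ p) + ∑[ p ∈ subsets n ] f (inside ∷ p)
∑-subsets n f = begin
  ∑ (map (outside ∷_) ps ++ map (inside ∷_) ps ++ []) f
    ≡⟨ ∑-++ (map (outside ∷_) ps) _ f ⟩
  ∑ (map (outside ∷_) ps) f + ∑ (map (inside ∷_) ps ++ []) f
    ≡⟨ cong (λ qs → ∑ (map (outside ∷_) ps) f + ∑ qs f) (++-identityʳ (map (inside ∷_) ps)) ⟩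
  ∑ (map (outside ∷_) ps) f + ∑ (map (inside ∷_) ps) f
    ≡⟨ cong₂ _+_ (∑-map (outside ∷_) ps f) (∑-map (inside ∷_) ps f) ⟩
  ∑[ p ∈ ps ] f (outside ∷ p) + ∑[ p ∈ ps ] f (inside ∷ p) ∎
  where
  open ≡-Reasoning
  ps = subsets n

supersets : Subset n → ℕ → ℤ
supersets {n} q k = ∑[ p ∈ subsets n ] when ((∣ p ∣ ℕ.≟ k) ×-dec (q ⊆? p)) 1ℤ

-- Kept apart from the binomial formula, which fails here: the truncated `k ∸ ∣ q ∣` is 0, so the
-- coefficient would be 1.
supersets-small : ∀ (q : Subset n) k → k ℕ.< ∣ q ∣ → supersets q k ≡ 0ℤ
supersets-small {n} q k k<q = ∑-zero (subsets n) λ {p} _ →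
  when-no ((∣ p ∣ ℕ.≟ k) ×-dec (q ⊆? p)) λ where
    (refl , q⊆p) → ℕ.<⇒≱ k<q (p⊆q⇒∣p∣≤∣q∣ q⊆p)

-- Decide vertex by vertex. A vertex of `q` is forced into `p`; any other vertex may or may not
-- belong to `p`, and the two counts add up by Pascal's rule. Writing the size as `∣ q ∣ + j` avoids
-- truncated subtraction in the induction.
supersets-+ : ∀ (q : Subset n) j → supersets q (∣ q ∣ ℕ.+ j) ≡ + ((n ∸ ∣ q ∣) C j)
supersets-+ [] zero    = refl
supersets-+ [] (suc j) = refl
supersets-+ {suc n} (inside ∷ q) j = begin
  supersets (inside ∷ q) (suc k)
    ≡⟨ ∑-subsets n _ ⟩
  _
    ≡⟨ cong₂ _+_
        (∑-zero (subsets n) λ {p} _ →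
          when-no ((∣ p ∣ ℕ.≟ suc k) ×-dec ((inside ∷ q) ⊆? (outside ∷ p)))
            λ (_ , s) → case s Vec.here of λ ())
        (∑-cong (subsets n) λ p →
          when-cong ((suc ∣ p ∣ ℕ.≟ suc k) ×-dec ((inside ∷ q) ⊆? (inside ∷ p)))
                    ((∣ p ∣ ℕ.≟ k) ×-dec (q ⊆? p))
                    (λ (e , s) → ℕ.suc-injective e , drop-∷-⊆ s)
                    (λ (e , s) → cong suc e , in⊆in s) (λ _ → refl)) ⟩
  0ℤ + supersets q k
    ≡⟨ ℤ.+-identityˡ _ ⟩
  supersets q k
    ≡⟨ supersets-+ q j ⟩
  + ((n ∸ ∣ q ∣) C j) ∎
  where
  open ≡-Reasoning
  k = ∣ q ∣ ℕ.+ j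
supersets-+ {suc n} (outside ∷ q) j = begin
  supersets (outside ∷ q) k
    ≡⟨ ∑-subsets n _ ⟩
  _
    ≡⟨ cong (_+ ∑[ p ∈ subsets n ] when ((suc ∣ p ∣ ℕ.≟ k) ×-dec ((outside ∷ q) ⊆? (inside ∷ p))) 1ℤ)
        (∑-cong (subsets n) λ p →
          when-cong ((∣ p ∣ ℕ.≟ k) ×-dec ((outside ∷ q) ⊆? (outside ∷ p)))
                    ((∣ p ∣ ℕ.≟ k) ×-dec (q ⊆? p))
                    (λ (e , s) → e , drop-∷-⊆ s) (λ (e , s) → e , out⊆ s) (λ _ → refl)) ⟩
  supersets q k + ∑[ p ∈ subsets n ] when ((suc ∣ p ∣ ℕ.≟ k) ×-dec ((outside ∷ q) ⊆? (inside ∷ p))) 1ℤ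
    ≡⟨ cong₂ _+_ (supersets-+ q j) (inner j) ⟩
  + ((n ∸ ∣ q ∣) C j) + previous j
    ≡⟨ pascal j ⟩
  + (suc (n ∸ ∣ q ∣) C j)
    ≡⟨ cong (λ m → + (m C j)) (ℕ.+-∸-assoc 1 (∣p∣≤n q)) ⟨
  + ((suc n ∸ ∣ q ∣) C j) ∎
  where
  open ≡-Reasoning
  k = ∣ q ∣ ℕ.+ j
  -- The Pascal term with lower index `j - 1`. It is 0 at `j = 0`, since a set of size `∣ q ∣`
  -- cannot contain `q` and a further vertex.
  previous : ℕ → ℤ
  previous zero    = 0ℤ
  previous (suc j) = + ((n ∸ ∣ q ∣) C j)

  inner : ∀ j → ∑[ p ∈ subsets n ]
    when ((suc ∣ p ∣ ℕ.≟ ∣ q ∣ ℕ.+ j) ×-dec ((outside ∷ q) ⊆? (inside ∷ p))) 1ℤ ≡ previous j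
  inner zero = ∑-zero (subsets n) λ {p} _ →
    when-no ((suc ∣ p ∣ ℕ.≟ ∣ q ∣ ℕ.+ 0) ×-dec ((outside ∷ q) ⊆? (inside ∷ p))) λ (e , s) →
      ℕ.<⇒≱ (ℕ.≤-reflexive (trans e (ℕ.+-identityʳ ∣ q ∣))) (p⊆q⇒∣p∣≤∣q∣ (drop-∷-⊆ s))
  inner (suc j) = trans
    (∑-cong (subsets n) λ p →
      when-cong ((suc ∣ p ∣ ℕ.≟ ∣ q ∣ ℕ.+ suc j) ×-dec ((outside ∷ q) ⊆? (inside ∷ p)))
                ((∣ p ∣ ℕ.≟ ∣ q ∣ ℕ.+ j) ×-dec (q ⊆? p))
                (λ (e , s) → ℕ.suc-injective (trans e (ℕ.+-suc ∣ q ∣ j)) , drop-∷-⊆ s)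
                (λ (e , s) → trans (cong suc e) (sym (ℕ.+-suc ∣ q ∣ j)) , out⊆ s)
                (λ _ → refl))
    (supersets-+ q j)

  pascal : ∀ j → + ((n ∸ ∣ q ∣) C j) + previous j ≡ + (suc (n ∸ ∣ q ∣) C j)
  pascal zero    = refl
  pascal (suc j) = cong +_ (trans (ℕ.+-comm (N C suc j) (N C j)) (nCk+nC[k+1]≡[n+1]C[k+1] N j))
    where N = n ∸ ∣ q ∣

supersets-count : ∀ (q : Subset n) {k} → ∣ q ∣ ≤ k →
                  supersets q k ≡ + ((n ∸ ∣ q ∣) C (k ∸ ∣ q ∣))
supersets-count q {k} q≤k =
  trans (cong (supersets q) (sym (ℕ.m+[n∸m]≡n q≤k))) (supersets-+ q (k ∸ ∣ q ∣))

-- Subgraphs without isolated vertices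

dec-true⁻ : (P? : Dec P) → does P? ≡ true → P
dec-true⁻ (yes p) _ = p

∈-tabulate⁺ : {P : Pred (Fin n) 0ℓ} (P? : Decidable P) → ∀ {v} → P v → v ∈ tabulate (does ∘ P?)
∈-tabulate⁺ P? {v} p = lookup⇒[]= v _ (trans (lookup∘tabulate _ v) (dec-true (P? v) p))

∈-tabulate⁻ : {P : Pred (Fin n) 0ℓ} (P? : Decidable P) → ∀ {v} → v ∈ tabulate (does ∘ P?) → P v
∈-tabulate⁻ P? {v} v∈ =
  dec-true⁻ (P? v) (trans (sym (lookup∘tabulate _ v)) ([]=⇒lookup v∈))

module _ {R : Rel (Fin n) 0ℓ} (R? : B.Decidable R) where

  -- Only vertices with a neighbour are kept, so the result has no isolated vertices whatever `R`
  -- is.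
  fromEdges : Subgraph n
  fromEdges = subgraph (tabulate λ u → does (any? (R? u)))
                       (tabulate λ u → tabulate λ v → does (R? u v))

  edge⁺ : ∀ {u v} → R u v → Edge fromEdges u v
  edge⁺ {u} {v} r = subst (v ∈_) (sym (lookup∘tabulate _ u)) (∈-tabulate⁺ (R? u) r)

  edge⁻ : ∀ {u v} → Edge fromEdges u v → R u v
  edge⁻ {u} {v} e = ∈-tabulate⁻ (R? u) (subst (v ∈_) (lookup∘tabulate _ u) e)

  vertex⁺ : ∀ {u v} → R u v → u ∈ vertices fromEdges
  vertex⁺ r = ∈-tabulate⁺ (any? ∘ R?) (_ , r)

  vertex⁻ : ∀ {u} → u ∈ vertices fromEdges → ∃[ v ] R u v
  vertex⁻ = ∈-tabulate⁻ (any? ∘ R?)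

  fromEdges-noIsolated : NoIsolatedVertices fromEdges
  fromEdges-noIsolated u u∈ with v , r ← vertex⁻ u∈ = v , edge⁺ r

  fromEdges-isSubgraph : (h : SimpleGraph n) → Symmetric R → R ⇒ Adj h →
                         fromEdges IsSubgraphOf h
  fromEdges-isSubgraph h R-sym R⇒Adj = record
    { edge-sym      = λ u v e → edge⁺ (R-sym (edge⁻ e))
    ; edge-vertices = λ u v e → vertex⁺ (edge⁻ e) , vertex⁺ (R-sym (edge⁻ e))
    ; edge-adj      = λ u v e → R⇒Adj (edge⁻ e)
    }

record IsEdgeInduced {n} (S : Subgraph n) (h : SimpleGraph n) : Set where
  constructor edgeInduced
  field
    isSubgraph : S IsSubgraphOf h
    noIsolated : NoIsolatedVertices S

open IsEdgeInduced

-- Every vertex is an endpoint of an edge, so equal edge relations force equal vertex sets.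
edgeInduced-ext : {h : SimpleGraph n} {S T : Subgraph n} → IsEdgeInduced S h → IsEdgeInduced T h →
                  (∀ u v → Edge S u v → Edge T u v) → (∀ u v → Edge T u v → Edge S u v) →
                  S ≡ T
edgeInduced-ext {S = S} {T} s t S⇒T T⇒S = cong₂ subgraph
  (⊆-antisym (vertices-⊆ s t S⇒T) (vertices-⊆ t s T⇒S))
  (Pointwise.Pointwise-≡⇒≡ (Pointwise.ext λ u → ⊆-antisym (S⇒T u _) (T⇒S u _)))
  where
  vertices-⊆ : ∀ {h : SimpleGraph _} {S T} → IsEdgeInduced S h → IsEdgeInduced T h →
               (∀ u v → Edge S u v → Edge T u v) → vertices S ⊆ vertices T
  vertices-⊆ s t S⇒T {u} u∈S with v , e ← noIsolated s u u∈S =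
    proj₁ (edge-vertices (isSubgraph t) u v (S⇒T u v e))

∈-subgraphs⁺ : (h : SimpleGraph n) {S : Subgraph n} → S IsSubgraphOf h → S List.∈ subgraphs h
∈-subgraphs⁺ h {subgraph p r} = ∈-filter⁺ (isSubgraphOf? h)
  (∈-cartesianProductWith⁺ subgraph (subsets-complete p) (vectors-complete subsets-complete r))

∈-subgraphs⁻ : (h : SimpleGraph n) {S : Subgraph n} → S List.∈ subgraphs h → S IsSubgraphOf h
∈-subgraphs⁻ {n} h S∈ = proj₂ (∈-filter⁻ (isSubgraphOf? h)
  {xs = cartesianProductWith subgraph (subsets n) (vectors (subsets n) n)} S∈)

subgraphs-unique : (h : SimpleGraph n) → Unique (subgraphs h)
subgraphs-unique {n} h = Unique.filter⁺ (isSubgraphOf? h)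
  (Unique.cartesianProductWith⁺ subgraph (λ { refl → refl , refl })
    (subsets-unique n) (vectors-unique (subsets-unique n) n))

-- Isomorphisms and the invariants they preserve

V-≡ : {S : Subgraph n} {x y : V S} → proj₁ x ≡ proj₁ y → x ≡ y
V-≡ {x = u , p} {.u , q} refl = cong (u ,_) ([]=-irrelevant p q)

≅-refl : {S : Subgraph n} → S ≅ S
≅-refl = ↔-id _ , λ _ _ → ⇔-id _

≅-sym : {S : Subgraph m} {T : Subgraph n} → S ≅ T → T ≅ S
≅-sym {S = S} {T} (φ , p) = ↔-sym φ , λ x y →
  subst₂ (λ s t → E T s t ⇔ E S (φ.from x) (φ.from y))
         (φ.strictlyInverseˡ x) (φ.strictlyInverseˡ y) (⇔-sym (p (φ.from x) (φ.from y)))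
  where module φ = Inverse φ

≅-trans : {S : Subgraph l} {T : Subgraph m} {U : Subgraph n} → S ≅ T → T ≅ U → S ≅ U
≅-trans (φ , p) (ψ , q) = ψ ↔-∘ φ , λ x y → q _ _ ⇔-∘ p x y

∣vertices∣-cong : {S : Subgraph m} {T : Subgraph n} → S ≅ T → ∣ vertices S ∣ ≡ ∣ vertices T ∣
∣vertices∣-cong {S = S} {T} (φ , _) =
  ↔⇒≡ (↔-sym (elements (vertices T)) ↔-∘ (φ ↔-∘ elements (vertices S)))

-- Links the `cv` of the formula with the vertex set used in counting supersets: endpoints of edges
-- are vertices, and without isolated vertices the converse holds.
cv-edgeInduced : {h : SimpleGraph n} {S : Subgraph n} → IsEdgeInduced S h → cv S ≡ ∣ vertices S ∣
cv-edgeInduced {n} {h} {S} s = trans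
  (length-bijection {R = λ u i → u ≡ proj₁ (el.to i)}
    (λ { refl refl → refl })
    (λ { {y = i} {j} refl e → trans (sym (el.strictlyInverseʳ i))
           (trans (cong el.from (V-≡ {S = S} e)) (el.strictlyInverseʳ j)) })
    (Unique.filter⁺ nonisolated? (Unique.allFin⁺ n)) (Unique.allFin⁺ ∣ vertices S ∣)
    (λ {u} u∈ → let v , e = proj₂ (∈-filter⁻ nonisolated? {xs = allFin n} u∈)
                    x     = u , proj₁ (edge-vertices (isSubgraph s) u v e)
                in el.from x , ∈-allFin _ , sym (cong proj₁ (el.strictlyInverseˡ x)))
    (λ {i} _ → proj₁ (el.to i)
             , ∈-filter⁺ nonisolated? (∈-allFin _) (noIsolated s _ (proj₂ (el.to i)))
             , refl))
  (length-tabulate id)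
  where
  module el = Inverse (elements (vertices S))
  nonisolated? : Decidable (λ u → ∃[ v ] Edge S u v)
  nonisolated? u = any? (edge? S u)

pairs : ∀ n → List (Fin n × Fin n)
pairs n = cartesianProduct (allFin n) (allFin n)

pairs-unique : ∀ n → Unique (pairs n)
pairs-unique n = Unique.cartesianProduct⁺ (Unique.allFin⁺ n) (Unique.allFin⁺ n)

∈-pairs : (x : Fin n × Fin n) → x List.∈ pairs n
∈-pairs (u , v) = ∈-cartesianProduct⁺ (∈-allFin u) (∈-allFin v)

OrientedEdge : Subgraph n → Fin n × Fin n → Set
OrientedEdge S (u , v) = u < v × Edge S u v

orientedEdge? : (S : Subgraph n) → Decidable (OrientedEdge S)
orientedEdge? S (u , v) = (u <? v) ×-dec edge? S u v

-- An isomorphism may reverse the orientation u < v of an edge, hence the two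
-- cases in the correspondence between oriented edges.
module _ {g : SimpleGraph m} {h : SimpleGraph n} {S : Subgraph m} {T : Subgraph n}
         (s : S IsSubgraphOf g) (t : T IsSubgraphOf h) (S≅T : S ≅ T) where

  private
    module φ = Inverse (proj₁ S≅T)

    -- The isomorphism as a relation on labels. Hiding the membership proof allows edges to be
    -- compared as pairs of elements of `Fin`.
    Maps : Fin m → Fin n → Set
    Maps u u′ = ∃[ p ] proj₁ (φ.to (u , p)) ≡ u′

    maps-functional : ∀ {u v w} → Maps u v → Maps u w → v ≡ w
    maps-functional {u} (p , refl) (q , refl) =
      cong (λ r → proj₁ (φ.to (u , r))) ([]=-irrelevant p q)

    maps-injective : ∀ {u v w} → Maps u w → Maps v w → u ≡ v
    maps-injective {u} {v} (p , refl) (q , e) = cong proj₁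
      (trans (sym (φ.strictlyInverseʳ (u , p)))
      (trans (cong φ.from (V-≡ {S = T} (sym e))) (φ.strictlyInverseʳ (v , q))))

    Corresponds : Fin m × Fin m → Fin n × Fin n → Set
    Corresponds (u , v) (u′ , v′) =
      u < v × u′ < v′ × (Maps u u′ × Maps v v′ ⊎ Maps u v′ × Maps v u′)

    edge-map⁻ : ∀ {u v u′ v′} → Maps u u′ → Maps v v′ → Edge T u′ v′ → Edge S u v
    edge-map⁻ (_ , refl) (_ , refl) e = Equivalence.from (proj₂ S≅T _ _) e

    preimage : ∀ {u′} → u′ ∈ vertices T → ∃[ u ] Maps u u′
    preimage {u′} p = let u , q = φ.from (u′ , p) in
      u , q , cong proj₁ (φ.strictlyInverseˡ (u′ , p))

    total : ∀ {x} → OrientedEdge S x → ∃[ y ] OrientedEdge T y × Corresponds x y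
    total {u , v} (u<v , e)
      with p , q ← edge-vertices s u v e
      with e′ ← Equivalence.to (proj₂ S≅T (u , p) (v , q)) e
      with <-cmp (proj₁ (φ.to (u , p))) (proj₁ (φ.to (v , q)))
    ... | tri< < _ _ = _ , (< , e′) , u<v , < , inj₁ ((p , refl) , (q , refl))
    ... | tri> _ _ > = _ , (> , edge-sym t _ _ e′) , u<v , > , inj₂ ((p , refl) , (q , refl))
    ... | tri≈ _ ≡ _ = contradiction
      (subst (Adj h _) (sym ≡) (edge-adj t _ _ e′)) (irrefl h)

    surjective : ∀ {y} → OrientedEdge T y → ∃[ x ] OrientedEdge S x × Corresponds x y
    surjective {u′ , v′} (u′<v′ , e)
      with p , q ← edge-vertices t u′ v′ e
      with u , u↦ ← preimage p
      with v , v↦ ← preimage q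
      with e′ ← edge-map⁻ u↦ v↦ e
      with <-cmp u v
    ... | tri< < _ _ = _ , (< , e′) , < , u′<v′ , inj₁ (u↦ , v↦)
    ... | tri> _ _ > = _ , (> , edge-sym s _ _ e′) , > , u′<v′ , inj₂ (v↦ , u↦)
    ... | tri≈ _ refl _ = contradiction (edge-adj s _ _ e′) (irrefl g)

    injective : ∀ {x x′ y} → Corresponds x y → Corresponds x′ y → x ≡ x′
    injective (_ , _ , inj₁ (a , b)) (_ , _ , inj₁ (c , d)) =
      cong₂ _,_ (maps-injective a c) (maps-injective b d)
    injective (_ , _ , inj₂ (a , b)) (_ , _ , inj₂ (c , d)) =
      cong₂ _,_ (maps-injective a c) (maps-injective b d)
    -- If one edge keeps its orientation and the other reverses it, the second is the first with its
    -- endpoints swapped, and both cannot be increasing.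
    injective (u<v , _ , inj₁ (a , b)) (v<u , _ , inj₂ (c , d)) =
      contradiction (subst₂ _<_ (maps-injective c b) (maps-injective d a) v<u) (<-asym u<v)
    injective (u<v , _ , inj₂ (a , b)) (v<u , _ , inj₁ (c , d)) =
      contradiction (subst₂ _<_ (maps-injective c b) (maps-injective d a) v<u) (<-asym u<v)

    functional : ∀ {x y y′} → Corresponds x y → Corresponds x y′ → y ≡ y′
    functional (_ , _ , inj₁ (a , b)) (_ , _ , inj₁ (c , d)) =
      cong₂ _,_ (maps-functional a c) (maps-functional b d)
    functional (_ , _ , inj₂ (a , b)) (_ , _ , inj₂ (c , d)) =
      cong₂ _,_ (maps-functional b d) (maps-functional a c)
    functional (_ , u<v , inj₁ (a , b)) (_ , v<u , inj₂ (c , d)) =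
      contradiction (subst₂ _<_ (maps-functional d b) (maps-functional c a) v<u) (<-asym u<v)
    functional (_ , u<v , inj₂ (a , b)) (_ , v<u , inj₁ (c , d)) =
      contradiction (subst₂ _<_ (maps-functional c a) (maps-functional d b) v<u) (<-asym u<v)

  edgeCount-cong : edgeCount S ≡ edgeCount T
  edgeCount-cong = length-bijection {R = Corresponds} injective functional
    (Unique.filter⁺ (orientedEdge? S) (pairs-unique m))
    (Unique.filter⁺ (orientedEdge? T) (pairs-unique n))
    (λ x∈ → let y , e , r = total (proj₂ (∈-filter⁻ (orientedEdge? S) {xs = pairs m} x∈))
            in y , ∈-filter⁺ (orientedEdge? T) (∈-pairs y) e , r)
    (λ y∈ → let x , e , r = surjective (proj₂ (∈-filter⁻ (orientedEdge? T) {xs = pairs n} y∈))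
            in x , ∈-filter⁺ (orientedEdge? S) (∈-pairs x) e , r)

-- Relabel the vertices of S by Fin ∣ vertices S ∣ and embed that into Fin k.
module _ {h : SimpleGraph n} {S : Subgraph n} (s : IsEdgeInduced S h)
         {k} (S≤k : ∣ vertices S ∣ ≤ k) where

  private
    module el = Inverse (elements (vertices S))

    ι : Fin ∣ vertices S ∣ → Fin k
    ι i = inject≤ i S≤k

    ι-injective : ∀ {i j} → ι i ≡ ι j → i ≡ j
    ι-injective = inject≤-injective S≤k S≤k _ _

    Image : Rel (Fin k) 0ℓ
    Image x y = ∃[ i ] ∃[ j ] ι i ≡ x × ι j ≡ y × E S (el.to i) (el.to j)

    image? : B.Decidable Image
    image? x y = any? λ i → any? λ j →
      (ι i ≟ x) ×-dec ((ι j ≟ y) ×-dec edge? S _ _)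

  copy : Subgraph k
  copy = fromEdges image?

  copy-edgeInduced : IsEdgeInduced copy (K k)
  copy-edgeInduced = edgeInduced
    (fromEdges-isSubgraph image? (K k)
      (λ (i , j , p , q , e) → j , i , q , p , edge-sym (isSubgraph s) _ _ e)
      (λ { (i , j , refl , q , e) p → irrefl h (subst (λ j → Adj h _ (proj₁ (el.to j)))
             (ι-injective (trans q (sym p))) (edge-adj (isSubgraph s) _ _ e)) }))
    (fromEdges-noIsolated image?)

  private
    image⁺ : ∀ {x y} → E S x y → Image (ι (el.from x)) (ι (el.from y))
    image⁺ {x} {y} e = el.from x , el.from y , refl , refl ,
      subst₂ (E S) (sym (el.strictlyInverseˡ x)) (sym (el.strictlyInverseˡ y)) e

    image⁻ : ∀ {x y} → Image (ι (el.from x)) (ι (el.from y)) → E S x y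
    image⁻ {x} {y} (i , j , p , q , e) = subst₂ (E S)
      (trans (cong el.to (ι-injective p)) (el.strictlyInverseˡ x))
      (trans (cong el.to (ι-injective q)) (el.strictlyInverseˡ y)) e

    to : V S → V copy
    to x@(u , u∈S) = ι (el.from x) ,
      vertex⁺ image? (image⁺ {x} {v , proj₂ (edge-vertices (isSubgraph s) u v e)} e)
      where
      -- Membership in `vertices copy` has to be witnessed by an edge; the image of any edge at `u`
      -- serves.
      v = proj₁ (noIsolated s u u∈S)
      e = proj₂ (noIsolated s u u∈S)

    from : V copy → V S
    from (x , x∈) = el.to (proj₁ (proj₂ (vertex⁻ image? x∈)))

    to-from : ∀ x → to (from x) ≡ x
    to-from (x , x∈) with vertex⁻ image? x∈
    ... | _ , i , _ , p , _ = V-≡ {S = copy} (trans (cong ι (el.strictlyInverseʳ i)) p)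

    from-to : ∀ x → from (to x) ≡ x
    from-to x with vertex⁻ image? (proj₂ (to x))
    ... | _ , i , _ , p , _ =
      trans (cong el.to (ι-injective p)) (el.strictlyInverseˡ x)

  copy-≅ : copy ≅ S
  copy-≅ = ≅-sym {S = S} {T = copy} (mk↔ₛ′ to from to-from from-to , λ x y →
    mk⇔ (edge⁺ image? ∘ image⁺ {x} {y}) (image⁻ {x} {y} ∘ edge⁻ image?))

-- Cancellation of signs

sign : Subgraph n → ℤ
sign S = -1ℤ ^ edgeCount S

sign-suc : {S : Subgraph m} {T : Subgraph n} → edgeCount T ≡ suc (edgeCount S) → sign S ≡ - sign T
sign-suc {S = S} e rewrite e = sym (trans (cong -_ (ℤ.-1*i≡-i (sign S))) (ℤ.neg-involutive (sign S)))

sign-neg : {x y : ℤ} → x ≡ - y → y ≡ - x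
sign-neg {y = y} refl = sym (ℤ.neg-involutive y)

edgeInducedWithin : SimpleGraph n → Subset n → List (Subgraph n)
edgeInducedWithin h p = filter (λ S → noIsolatedVertices? S ×-dec (vertices S ⊆? p)) (subgraphs h)

module _ (h : SimpleGraph n) (p : Subset n) where

  private
    P? : Decidable (λ S → NoIsolatedVertices S × vertices S ⊆ p)
    P? S = noIsolatedVertices? S ×-dec (vertices S ⊆? p)

  ∈-within⁺ : ∀ {S} → IsEdgeInduced S h → vertices S ⊆ p → S List.∈ edgeInducedWithin h p
  ∈-within⁺ s S⊆p = ∈-filter⁺ P? (∈-subgraphs⁺ h (isSubgraph s)) (noIsolated s , S⊆p)

  ∈-within⁻ : ∀ {S} → S List.∈ edgeInducedWithin h p → IsEdgeInduced S h × vertices S ⊆ p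
  ∈-within⁻ S∈ with S∈h , s , S⊆p ← ∈-filter⁻ P? {xs = subgraphs h} S∈ =
    edgeInduced (∈-subgraphs⁻ h S∈h) s , S⊆p

  within-unique : Unique (edgeInducedWithin h p)
  within-unique = Unique.filter⁺ P? (subgraphs-unique h)

module Toggle {h : SimpleGraph n} {a b : Fin n} (a<b : a < b) (ab : Adj h a b) where

  IsAB : Rel (Fin n) 0ℓ
  IsAB u v = (u ≡ a × v ≡ b) ⊎ (u ≡ b × v ≡ a)

  isAB? : B.Decidable IsAB
  isAB? u v = ((u ≟ a) ×-dec (v ≟ b)) ⊎-dec ((u ≟ b) ×-dec (v ≟ a))

  isAB-sym : Symmetric IsAB
  isAB-sym (inj₁ (x , y)) = inj₂ (y , x)
  isAB-sym (inj₂ (x , y)) = inj₁ (y , x)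

  -- Symmetric difference of the edge set with the single edge `ab`; `IsAB` contains both
  -- orientations, which keeps the relation symmetric.
  Toggled : Subgraph n → Rel (Fin n) 0ℓ
  Toggled S u v = (Edge S u v × ¬ IsAB u v) ⊎ (¬ Edge S u v × IsAB u v)

  toggled? : (S : Subgraph n) → B.Decidable (Toggled S)
  toggled? S u v = (edge? S u v ×-dec ¬? (isAB? u v)) ⊎-dec (¬? (edge? S u v) ×-dec isAB? u v)

  -- The vertex set is recomputed from the edges: removing `ab` may isolate `a` or `b`, which must
  -- then disappear, and adding it may bring them in.
  toggle : Subgraph n → Subgraph n
  toggle S = fromEdges (toggled? S)

  toggle-edgeInduced : ∀ {S} → IsEdgeInduced S h → IsEdgeInduced (toggle S) h
  toggle-edgeInduced {S} s = edgeInduced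
    (fromEdges-isSubgraph (toggled? S) h
      (Sum.map (λ (e , ¬x) → edge-sym (isSubgraph s) _ _ e , ¬x ∘ isAB-sym)
               (λ (¬e , x) → ¬e ∘ edge-sym (isSubgraph s) _ _ , isAB-sym x))
      λ where
        (inj₁ (e , _)) → edge-adj (isSubgraph s) _ _ e
        (inj₂ (_ , inj₁ (refl , refl))) → ab
        (inj₂ (_ , inj₂ (refl , refl))) → symm h ab)
    (fromEdges-noIsolated (toggled? S))

  toggle-⊆ : ∀ {S p} → IsEdgeInduced S h → a ∈ p → b ∈ p →
             vertices S ⊆ p → vertices (toggle S) ⊆ p
  toggle-⊆ {S} s a∈p b∈p S⊆p u∈ with vertex⁻ (toggled? S) u∈
  ... | _ , inj₁ (e , _) = S⊆p (proj₁ (edge-vertices (isSubgraph s) _ _ e))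
  ... | _ , inj₂ (_ , inj₁ (refl , refl)) = a∈p
  ... | _ , inj₂ (_ , inj₂ (refl , refl)) = b∈p

  -- Toggling forgets isolated vertices, so this needs `S` to have none; then it suffices to compare
  -- edges.
  toggle-involutive : ∀ {S} → IsEdgeInduced S h → toggle (toggle S) ≡ S
  toggle-involutive {S} s = edgeInduced-ext {h = h}
    (toggle-edgeInduced (toggle-edgeInduced s)) s to from
    where
    to : ∀ u v → Edge (toggle (toggle S)) u v → Edge S u v
    to u v e with edge⁻ (toggled? (toggle S)) e
    ... | inj₁ (e′ , ¬x) with edge⁻ (toggled? S) e′
    ...   | inj₁ (e″ , _) = e″
    ...   | inj₂ (_ , x)  = contradiction x ¬x
    -- Were `ab` not an edge of `S`, the first toggle would have added it.
    to u v e | inj₂ (¬e′ , x) = decidable-stable (edge? S u v) λ ¬e →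
      ¬e′ (edge⁺ (toggled? S) (inj₂ (¬e , x)))

    from : ∀ u v → Edge S u v → Edge (toggle (toggle S)) u v
    from u v e with isAB? u v
    ... | no ¬x = edge⁺ (toggled? (toggle S)) (inj₁ (edge⁺ (toggled? S) (inj₁ (e , ¬x)) , ¬x))
    ... | yes x = edge⁺ (toggled? (toggle S)) (inj₂ ((λ e′ → ¬both (edge⁻ (toggled? S) e′)) , x))
      where
      ¬both : ¬ Toggled S u v
      ¬both (inj₁ (_ , ¬x)) = ¬x x
      ¬both (inj₂ (¬e , _)) = ¬e e

  isAB-oriented : ∀ {u v} → u < v → IsAB u v → (u , v) ≡ (a , b)
  isAB-oriented _   (inj₁ (refl , refl)) = refl
  isAB-oriented u<v (inj₂ (refl , refl)) = contradiction a<b (<-asym u<v)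

  toggle-elsewhere : ∀ S y → y ≢ (a , b) → OrientedEdge S y → OrientedEdge (toggle S) y
  toggle-elsewhere S _ y≢ab (u<v , e) =
    u<v , edge⁺ (toggled? S) (inj₁ (e , y≢ab ∘ isAB-oriented u<v))

  toggle-elsewhere⁻ : ∀ S y → y ≢ (a , b) → OrientedEdge (toggle S) y → OrientedEdge S y
  toggle-elsewhere⁻ S _ y≢ab (u<v , e) with edge⁻ (toggled? S) e
  ... | inj₁ (e′ , _) = u<v , e′
  ... | inj₂ (_ , x)  = contradiction (isAB-oriented u<v x) y≢ab

  -- Since `a < b`, the only oriented pair whose status changes is `(a , b)`, so the two edge counts
  -- differ by exactly one.
  toggle-sign : ∀ S → sign S ≡ - sign (toggle S)
  toggle-sign S with edge? S a b
  ... | no ¬e = sign-suc {S = S} {toggle S}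
    (length-filter-suc (orientedEdge? S) (orientedEdge? (toggle S)) (pairs-unique n) (∈-pairs (a , b))
      (¬e ∘ proj₂) (a<b , edge⁺ (toggled? S) (inj₂ (¬e , inj₁ (refl , refl))))
      (toggle-elsewhere S) (toggle-elsewhere⁻ S))
  ... | yes e = sign-neg (sign-suc {S = toggle S} {S}
    (length-filter-suc (orientedEdge? (toggle S)) (orientedEdge? S) (pairs-unique n) (∈-pairs (a , b))
      (λ (_ , e′) → removed (edge⁻ (toggled? S) e′)) (a<b , e)
      (toggle-elsewhere⁻ S) (toggle-elsewhere S)))
    where
    removed : ¬ Toggled S a b
    removed (inj₁ (_ , ¬x)) = ¬x (inj₁ (refl , refl))
    removed (inj₂ (¬e , _)) = ¬e e

  ∑-sign≡0 : ∀ p → a ∈ p → b ∈ p → ∑ (edgeInducedWithin h p) sign ≡ 0ℤ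
  ∑-sign≡0 p a∈p b∈p = i≡-i⇒i≡0 _ (trans
    -- The relation carries membership in `Ss` because injectivity of `toggle` comes from the
    -- involution law, available only for edge-induced subgraphs.
    (∑-bijection {R = λ S T → S List.∈ Ss × T ≡ toggle S} {g = -_ ∘ sign}
      (λ { (S∈ , refl) (T∈ , e) → trans (sym (involutive S∈)) (trans (cong toggle e) (involutive T∈)) })
      (λ { (_ , refl) (_ , refl) → refl })
      (λ { {S} (_ , refl) → toggle-sign S })
      (within-unique h p) (within-unique h p)
      (λ {S} S∈ → toggle S , closed S∈ , S∈ , refl)
      (λ {S} S∈ → toggle S , closed S∈ , closed S∈ , sym (involutive S∈)))
    (∑-neg Ss sign))
    where
    Ss = edgeInducedWithin h p

    closed : ∀ {S} → S List.∈ Ss → toggle S List.∈ Ss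
    closed S∈ with s , S⊆p ← ∈-within⁻ h p S∈ =
      ∈-within⁺ h p (toggle-edgeInduced s) (toggle-⊆ s a∈p b∈p S⊆p)

    involutive : ∀ {S} → S List.∈ Ss → toggle (toggle S) ≡ S
    involutive S∈ = toggle-involutive (proj₁ (∈-within⁻ h p S∈))

dependent-edge : (h : SimpleGraph n) {p : Subset n} → ¬ IsIndependent h p →
                 ∃[ a ] ∃[ b ] a ∈ p × b ∈ p × a < b × Adj h a b
dependent-edge h {p} ¬ind with any? (λ u → any? λ v → (u ∈? p) ×-dec ((v ∈? p) ×-dec adj? h u v))
... | no ¬e = contradiction (λ u v u∈p v∈p e → ¬e (u , v , u∈p , v∈p , e)) ¬ind
... | yes (u , v , u∈p , v∈p , e) with <-cmp u v
...   | tri< < _ _    = u , v , u∈p , v∈p , < , e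
...   | tri> _ _ >    = v , u , v∈p , u∈p , > , symm h e
...   | tri≈ _ refl _ = contradiction e (irrefl h)

noEdge? : B.Decidable {A = Fin n} {B = Fin n} λ _ _ → ⊥
noEdge? _ _ = no λ ()

edgeless : Subgraph n
edgeless = fromEdges noEdge?

edgeless-edgeInduced : (h : SimpleGraph n) → IsEdgeInduced edgeless h
edgeless-edgeInduced h = edgeInduced
  (fromEdges-isSubgraph noEdge? h (λ ()) (λ ())) (fromEdges-noIsolated noEdge?)

¬edge-edgeless : ∀ {u v : Fin n} → ¬ Edge edgeless u v
¬edge-edgeless = edge⁻ noEdge?

edgeCount-edgeless : edgeCount (edgeless {n}) ≡ 0
edgeCount-edgeless {n} = cong length
  (filter-none (orientedEdge? edgeless) {xs = pairs n}
    (All.universal (λ _ → ¬edge-edgeless ∘ proj₂) (pairs n)))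

∑-sign-within : (h : SimpleGraph n) (p : Subset n) →
                ∑ (edgeInducedWithin h p) sign ≡ when (isIndependent? h p) 1ℤ
∑-sign-within {n} h p with isIndependent? h p
... | no ¬ind with a , b , a∈p , b∈p , a<b , ab ← dependent-edge h ¬ind =
  trans (Toggle.∑-sign≡0 {h = h} a<b ab p a∈p b∈p) (sym (when-no (isIndependent? h p) ¬ind))
... | yes ind = trans
  (∑-single (within-unique h p)
    (∈-within⁺ h p (edgeless-edgeInduced h)
      (λ u∈ → ⊥-elim (proj₂ (vertex⁻ noEdge? u∈))))
    (λ S∈ S≢ → contradiction (only-edgeless (∈-within⁻ h p S∈)) S≢))
  (trans (cong (-1ℤ ^_) (edgeCount-edgeless {n})) (sym (when-yes (isIndependent? h p) ind)))
  where
  only-edgeless : ∀ {S} → IsEdgeInduced S h × vertices S ⊆ p → S ≡ edgeless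
  only-edgeless {S} (s , S⊆p) = edgeInduced-ext {h = h} s (edgeless-edgeInduced h)
    (λ u v e → let u∈S , v∈S = edge-vertices (isSubgraph s) u v e in
      contradiction (edge-adj (isSubgraph s) u v e) (ind u v (S⊆p u∈S) (S⊆p v∈S)))
    (λ u v e → contradiction e ¬edge-edgeless)

-- Isomorphism classes

unlabeled-edgeInduced : (h : SimpleGraph n) {A : Subgraph n} →
                        A List.∈ unlabeledSubgraphs h → IsEdgeInduced A h
unlabeled-edgeInduced h A∈
  with A∈h , a ← ∈-filter⁻ noIsolatedVertices? {xs = subgraphs h} (∈-deduplicate⁻ _≅?_ _ A∈)
  = edgeInduced (∈-subgraphs⁻ h A∈h) a

deduplicate-allPairs : {A : Set} {R : Rel A 0ℓ} (R? : B.Decidable R) →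
                       ∀ xs → AllPairs (λ x y → ¬ R x y) (deduplicate R? xs)
deduplicate-allPairs R? []       = []
deduplicate-allPairs R? (x ∷ xs) =
  All.all-filter (¬? ∘ R? x) (deduplicate R? xs) ∷
  AllPairs.filter⁺ (¬? ∘ R? x) (deduplicate-allPairs R? xs)

-- `AllPairs` compares earlier entries with later ones only; symmetry of `R` covers the opposite
-- order.
allPairs-¬-injective : {A : Set} {R : Rel A 0ℓ} → Symmetric R → ∀ {xs} →
  AllPairs (λ x y → ¬ R x y) xs → ∀ {x y} → x List.∈ xs → y List.∈ xs → R x y → x ≡ y
allPairs-¬-injective s (_ ∷ _)  (here refl) (here refl) _ = refl
allPairs-¬-injective s (px ∷ _) (here refl) (there y∈)  r = contradiction r (All.lookup px y∈)
allPairs-¬-injective s (px ∷ _) (there x∈)  (here refl) r = contradiction (s r) (All.lookup px x∈)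
allPairs-¬-injective s (_ ∷ p)  (there x∈)  (there y∈)  r = allPairs-¬-injective s p x∈ y∈ r

module _ (g : SimpleGraph n) where

  private
    non-isomorphic : AllPairs (λ A B → ¬ A ≅ B) (unlabeledSubgraphs g)
    non-isomorphic = deduplicate-allPairs _≅?_ _

  unlabeled-unique : Unique (unlabeledSubgraphs g)
  unlabeled-unique = AllPairs.map (λ { {A} ¬A≅B refl → ¬A≅B (≅-refl {S = A}) }) non-isomorphic

  unlabeled-injective : ∀ {A B} → A List.∈ unlabeledSubgraphs g → B List.∈ unlabeledSubgraphs g →
                        A ≅ B → A ≡ B
  unlabeled-injective = allPairs-¬-injective (λ {A} {B} → ≅-sym {S = A} {T = B}) non-isomorphic

  unlabeled-representative : ∀ {B} → IsEdgeInduced B g →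
                             ∃[ A ] A List.∈ unlabeledSubgraphs g × A ≅ B
  unlabeled-representative {B} b = List.find
    (Any.deduplicate⁺ _≅?_ (λ {A} {A′} A′≅A A≅B → ≅-trans {S = A′} {T = A} {U = B} A′≅A A≅B)
      (List.lose (∈-filter⁺ noIsolatedVertices? (∈-subgraphs⁺ g (isSubgraph b)) (noIsolated b))
                 (≅-refl {S = B})))

-- Used contrapositively: a subgraph of `h` with an isolated vertex is a copy of no class, so it
-- drops out of the sum.
noIsolated-cong : {g : SimpleGraph m} {A : Subgraph m} {S : Subgraph n} →
                  IsEdgeInduced A g → A ≅ S → NoIsolatedVertices S
noIsolated-cong {A = A} {S} a (φ , p) u u∈S =
  let x     = φ.from (u , u∈S)
      v , e = noIsolated a (proj₁ x) (proj₂ x)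
      y     = v , proj₂ (edge-vertices (isSubgraph a) _ v e)
  in proj₁ (φ.to y) , subst (λ z → E S z (φ.to y)) (φ.strictlyInverseˡ (u , u∈S))
                            (Equivalence.to (p x y) e)
  where module φ = Inverse φ

-- Contribution of a single subgraph of `h`

module _ (h : SimpleGraph n) (k : ℕ) where

  coefficient : Subgraph k → ℤ
  coefficient A = sign A * + ((n ∸ cv A) C (k ∸ cv A))

  private
    classes : List (Subgraph k)
    classes = unlabeledSubgraphs (K k)

  -- With an isolated vertex, or more than `k` vertices, `S` matches no class; in the latter case
  -- the superset count vanishes too. Otherwise the representative of `copy` is the only match, and
  -- the isomorphism carries its `edgeCount` and `cv` over to `S`.
  ∑-class : ∀ {S} → S IsSubgraphOf h →
            ∑[ A ∈ classes ] when (A ≅? S) (coefficient A) ≡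
            when (noIsolatedVertices? S) (sign S * supersets (vertices S) k)
  ∑-class {S} S≤h with noIsolatedVertices? S
  ... | no ¬s = trans
    (∑-zero classes λ {A} A∈ →
      when-no (A ≅? S) (¬s ∘ noIsolated-cong {A = A} {S} (unlabeled-edgeInduced (K k) A∈)))
    (sym (when-no (noIsolatedVertices? S) ¬s))
  ... | yes noIso with ∣ vertices S ∣ ℕ.≤? k
  ...   | no S≰k = trans
    (∑-zero classes λ {A} A∈ → when-no (A ≅? S) λ A≅S →
      S≰k (subst (_≤ k) (∣vertices∣-cong {S = A} {S} A≅S) (∣p∣≤n (vertices A))))
    (sym (trans (when-yes (noIsolatedVertices? S) noIso)
         (trans (cong (sign S *_) (supersets-small (vertices S) k (ℕ.≰⇒> S≰k)))
                (ℤ.*-zeroʳ (sign S)))))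
  ...   | yes S≤k
    with A , A∈ , A≅copy ← unlabeled-representative (K k)
           (copy-edgeInduced {h = h} (edgeInduced S≤h noIso) S≤k) = begin
    ∑[ B ∈ classes ] when (B ≅? S) (coefficient B)
      ≡⟨ ∑-single (unlabeled-unique (K k)) A∈ (λ {B} B∈ B≢A → when-no (B ≅? S) λ B≅S →
           B≢A (unlabeled-injective (K k) B∈ A∈
             (≅-trans {S = B} {S} {A} B≅S (≅-sym {S = A} {S} A≅S)))) ⟩
    when (A ≅? S) (coefficient A)
      ≡⟨ when-yes (A ≅? S) A≅S ⟩
    sign A * + ((n ∸ cv A) C (k ∸ cv A))
      ≡⟨ cong₂ (λ e v → (-1ℤ ^ e) * + ((n ∸ v) C (k ∸ v))) sameEdgeCount sameVertexCount ⟩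
    sign S * + ((n ∸ ∣ vertices S ∣) C (k ∸ ∣ vertices S ∣))
      ≡⟨ cong (sign S *_) (supersets-count (vertices S) S≤k) ⟨
    sign S * supersets (vertices S) k
      ≡⟨ when-yes (noIsolatedVertices? S) noIso ⟨
    when (noIsolatedVertices? S) (sign S * supersets (vertices S) k) ∎
    where
    open ≡-Reasoning
    a : IsEdgeInduced A (K k)
    a = unlabeled-edgeInduced (K k) A∈

    A≅S : A ≅ S
    A≅S = ≅-trans {S = A} {copy {h = h} (edgeInduced S≤h noIso) S≤k} {S} A≅copy
                  (copy-≅ {h = h} (edgeInduced S≤h noIso) S≤k)

    sameEdgeCount : edgeCount A ≡ edgeCount S
    sameEdgeCount = edgeCount-cong {g = K k} {h} (isSubgraph a) S≤h A≅S

    sameVertexCount : cv A ≡ ∣ vertices S ∣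
    sameVertexCount = trans (cv-edgeInduced a) (∣vertices∣-cong {S = A} {S} A≅S)

  -- Arranges the conditions for the second exchange: the size of `p` stands outside, and what
  -- remains inside is the predicate that defines `edgeInducedWithin`.
  when-∑-supersets : {P : Set} (P? : Dec P) (S : Subgraph n) →
    when P? (sign S * supersets (vertices S) k) ≡
    ∑[ p ∈ subsets n ] when (∣ p ∣ ℕ.≟ k) (when (P? ×-dec (vertices S ⊆? p)) (sign S))
  when-∑-supersets (no _)  S = sym (∑-zero (subsets n) λ {p} _ → when-zero (∣ p ∣ ℕ.≟ k))
  when-∑-supersets (yes _) S =
    trans (∑-distribˡ-* (sign S) (subsets n) _) (∑-cong (subsets n) λ p → trans
      (*-when (sign S) ((∣ p ∣ ℕ.≟ k) ×-dec (vertices S ⊆? p)))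
      (trans (cong (when ((∣ p ∣ ℕ.≟ k) ×-dec (vertices S ⊆? p))) (ℤ.*-identityʳ (sign S)))
             (when-× (∣ p ∣ ℕ.≟ k) (vertices S ⊆? p))))

proposition13 : (n k : ℕ) → k ≤ n → (h : SimpleGraph n) →
    + (I-K̄ k h) ≡
    ∑[ A ∈ unlabeledSubgraphs (K k) ]
    ((-1ℤ ^ edgeCount A) * + ((n ∸ cv A) C (k ∸ cv A)) * + (I A h))
proposition13 n k _ h = sym (begin
  ∑[ A ∈ As ] (coefficient h k A * + I A h)
    ≡⟨ ∑-cong As (λ A → trans
         (cong (coefficient h k A *_) (length-filter-∑ (A ≅?_) Ss))
         (trans (∑-distribˡ-* (coefficient h k A) Ss _)
                (∑-cong Ss λ S → trans (*-when (coefficient h k A) (A ≅? S))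
                                       (cong (when (A ≅? S)) (ℤ.*-identityʳ (coefficient h k A)))))) ⟩
  ∑[ A ∈ As ] ∑[ S ∈ Ss ] when (A ≅? S) (coefficient h k A)
    ≡⟨ ∑-comm As Ss _ ⟩
  ∑[ S ∈ Ss ] ∑[ A ∈ As ] when (A ≅? S) (coefficient h k A)
    ≡⟨ ∑-cong-∈ Ss (λ {S} S∈ → trans
         (∑-class h k (∈-subgraphs⁻ h S∈))
         (when-∑-supersets h k (noIsolatedVertices? S) S)) ⟩
  ∑[ S ∈ Ss ] ∑[ p ∈ ps ] when (∣ p ∣ ℕ.≟ k) (term S p)
    ≡⟨ ∑-comm Ss ps _ ⟩
  ∑[ p ∈ ps ] ∑[ S ∈ Ss ] when (∣ p ∣ ℕ.≟ k) (term S p)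
    ≡⟨ ∑-cong ps (λ p → ∑-when (∣ p ∣ ℕ.≟ k) Ss (λ S → term S p)) ⟩
  ∑[ p ∈ ps ] when (∣ p ∣ ℕ.≟ k) (∑[ S ∈ Ss ] term S p)
    -- For fixed `p`, the bracket in `term` folds back into the filter defining
    -- `edgeInducedWithin h p`, whose signed sum is known.
    ≡⟨ ∑-cong ps (λ p → trans
         (cong (when (∣ p ∣ ℕ.≟ k)) (trans (sym (∑-filter _ Ss sign)) (∑-sign-within h p)))
         (sym (when-× (∣ p ∣ ℕ.≟ k) (isIndependent? h p)))) ⟩
  ∑[ p ∈ ps ] when ((∣ p ∣ ℕ.≟ k) ×-dec isIndependent? h p) 1ℤ
    ≡⟨ length-filter-∑ (λ p → (∣ p ∣ ℕ.≟ k) ×-dec isIndependent? h p) ps ⟨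
  + I-K̄ k h ∎)
  where
  open ≡-Reasoning
  As = unlabeledSubgraphs (K k)
  Ss = subgraphs h
  ps = subsets n

  term : Subgraph n → Subset n → ℤ
  term S p = when (noIsolatedVertices? S ×-dec (vertices S ⊆? p)) (sign S)
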